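{- The CNF formula $\mathcal F_n$ of \textsc{Sink-or-Clash} has an efficient resolution proof. That is, there are resolution proofs $\mathcal P_n$ of $\mathcal F_n$ ($n\ge 1$) such that, with $N=n2^n$ the number of variables of $\mathcal F_n$, $\log(s(\mathcal P_n))+w(\mathcal P_n)\in\mathrm{polylog}(N)$.
   Context: Let $\mathfrak{C}=\{0,1\}^n$, $[n]=\{1,\dots,n\}$. For each $u\in\mathfrak{C}$ and $i\in[n]$ there is a Boolean variable $x_{u,i}$ (encoding the $i$-th bit of the outmap value at $u$). For distinct $u,v\in\mathfrak{C}$ let $I_{u,v}=\{i\in[n]\mid u_i\ne v_i\}$. The CNF formula of \textsc{Sink-or-Clash} is $$\mathcal F_n=\Big(\bigwedge_{u\in\mathfrak{C}}\bigvee_{i\in[n]}x_{u,i}\Big)\wedge\Big(\bigwedge_{u,v\in\mathfrak{C},\,u\ne v}\ \bigwedge_{o\in\{0,1\}^{I_{u,v}}}\ \bigvee_{i\in I_{u,v}}(x_{u,i}\ne o_i\vee x_{v,i}\ne o_i)\Big),$$ where $x_{u,i}\ne o_i$ stands for the literal $x_{u,i}$ if $o_i=0$ and $\neg x_{u,i}$ if $o_i=1$. (It states that no vertex is a sink and no two distinct vertices clash.) A resolution step derives the clause $C\vee D$ from clauses $C\vee x$ and $D\vee\neg x$, for disjunctive clauses $C,D$ and a literal $x$. A resolution proof of an unsatisfiable CNF formula is a sequence of resolution steps, each using clauses of the formula or clauses derived in earlier steps, ending with the empty clause $\bot$. Its size $s(\mathcal P)$ is the number of resolution steps and its width $w(\mathcal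 P)$ is the largest number of literals in any clause of the proof. A resolution proof $\mathcal P$ of a formula on $N$ variables is efficient if $\log(s(\mathcal P))+w(\mathcal P)\in\mathrm{polylog}(N)$, i.e. is bounded by a fixed polynomial in $\log N$ (uniformly over the family). -}

module Defs where

open import Data.Bool.Base using (Bool; true; false)
import Data.Bool.Properties as Bool
open import Data.Fin.Base using (Fin)
import Data.Fin.Properties as Fin
open import Data.List.Base
  using (List; []; _∷_; _++_; allFin; cartesianProduct; cartesianProductWith;
         concat; concatMap; deduplicate; filter; foldr; length; map)
open import Data.List.Relation.Binary.BagAndSetEquality using (_∼[_]_; set)
open import Data.List.Relation.Unary.Any using (Any)
open import Data.Nat.Base using (ℕ; zero; suc; _+_; _*_; _⊔_)
open import Data.Product.Base using (_×_; _,_)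
import Data.Product.Properties as Product
open import Data.Vec.Base as Vec using (Vec; []; _∷_)
import Data.Vec.Properties as Vec
open import Relation.Binary.Definitions using (DecidableEquality)
open import Relation.Binary.PropositionalEquality using (_≡_; refl; cong)
open import Relation.Nullary.Decidable using (no; map′; ¬?)

data Literal (V : Set) : Set where
  pos neg : V → Literal V

negate : ∀ {V} → Literal V → Literal V
negate (pos v) = neg v
negate (neg v) = pos v

-- A list of literals stands for the set of its elements: order and repetition
-- are ignored both in resolution steps and when counting literals.
Clause : Set → Set
Clause V = List (Literal V)

CNF : Set → Set
CNF V = List (Clause V)

module Resolution {V : Set} (_≟_ : DecidableEquality V) where

  _≟ˡ_ : DecidableEquality (Literal V)
  pos v ≟ˡ pos w = map′ (cong pos) (λ { refl → refl }) (v ≟ w)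
  pos v ≟ˡ neg w = no λ ()
  neg v ≟ˡ pos w = no λ ()
  neg v ≟ˡ neg w = map′ (cong neg) (λ { refl → refl }) (v ≟ w)

  clauseWidth : Clause V → ℕ
  clauseWidth C = length (deduplicate _≟ˡ_ C)

  infix 4 _∈ᶜ_

  _∈ᶜ_ : Clause V → List (Clause V) → Set
  C ∈ᶜ Γ = Any (C ∼[ set ]_) Γ

  -- Derivation F Γ: a sequence of resolution steps from F whose conclusions
  -- are the clauses of Γ, the most recent one first. There is no weakening rule.
  data Derivation (F : CNF V) : List (Clause V) → Set where
    start   : Derivation F []
    resolve : ∀ {Γ E} (C D : Clause V) (x : Literal V) →
              Derivation F Γ →
              (x ∷ C) ∈ᶜ (F ++ Γ) →
              (negate x ∷ D) ∈ᶜ (F ++ Γ) →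
              E ∼[ set ] (C ++ D) →
              Derivation F (E ∷ Γ)

  derivationSize : ∀ {F Γ} → Derivation F Γ → ℕ
  derivationSize start                   = 0
  derivationSize (resolve _ _ _ P _ _ _) = suc (derivationSize P)

  -- The clauses of a proof are the premises and conclusions of its steps; in
  -- particular the clauses of F that are used count towards the width.
  derivationWidth : ∀ {F Γ} → Derivation F Γ → ℕ
  derivationWidth start = 0
  derivationWidth (resolve {E = E} C D x P _ _ _) =
    clauseWidth (x ∷ C) ⊔ clauseWidth (negate x ∷ D) ⊔ clauseWidth E
      ⊔ derivationWidth P

  record Refutation (F : CNF V) : Set where
    field
      {earlier}  : List (Clause V)
      derivation : Derivation F ([] ∷ earlier)

    size : ℕ
    size = derivationSize derivation

    width : ℕ
    width = derivationWidth derivation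

Vertex : ℕ → Set
Vertex n = Vec Bool n

_≟ᵛ_ : ∀ {n} → DecidableEquality (Vertex n)
_≟ᵛ_ = Vec.≡-dec Bool._≟_

-- (u , i) is the variable x_{u,i}.
Var : ℕ → Set
Var n = Vertex n × Fin n

_≟ˣ_ : ∀ {n} → DecidableEquality (Var n)
_≟ˣ_ = Product.≡-dec _≟ᵛ_ Fin._≟_

boolVecs : ∀ n → List (Vec Bool n)
boolVecs zero    = [] ∷ []
boolVecs (suc n) = cartesianProductWith _∷_ (false ∷ true ∷ []) (boolVecs n)

-- The literal expressing that the value of v differs from b.
_≠ˡ_ : ∀ {V : Set} → V → Bool → Literal V
v ≠ˡ false = pos v
v ≠ˡ true  = neg v

differing : ∀ {n} → Vertex n → Vertex n → List (Fin n)
differing {n} u v =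
  filter (λ i → ¬? (Vec.lookup u i Bool.≟ Vec.lookup v i)) (allFin n)

notSink : ∀ {n} → Vertex n → Clause (Var n)
notSink {n} u = map (λ i → pos (u , i)) (allFin n)

-- o assigns a bit to each coordinate in which u and v differ, listed in the
-- order of `differing u v`.
notClash : ∀ {n} (u v : Vertex n) → Vec Bool (length (differing u v)) →
           Clause (Var n)
notClash u v o = concat (Vec.toList (Vec.zipWith
  (λ i b → ((u , i) ≠ˡ b) ∷ ((v , i) ≠ˡ b) ∷ [])
  (Vec.fromList (differing u v)) o))

distinctPairs : ∀ n → List (Vertex n × Vertex n)
distinctPairs n = filter (λ (u , v) → ¬? (u ≟ᵛ v))
  (cartesianProduct (boolVecs n) (boolVecs n))

sinkOrClash : ∀ n → CNF (Var n)
sinkOrClash n =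
  map notSink (boolVecs n) ++
  concatMap (λ (u , v) → map (notClash u v) (boolVecs (length (differing u v))))
            (distinctPairs n)

-- Polynomials with coefficients in ℕ, constant term first. Restricting to ℕ
-- loses nothing for upper bounds: on nonnegative arguments every real
-- polynomial is dominated by one of these.
Polynomial : Set
Polynomial = List ℕ

⟦_⟧ : Polynomial → ℕ → ℕ
⟦ p ⟧ x = foldr (λ a r → a + x * r) 0 p

module SinkOrClash {n : ℕ} = Resolution (_≟ˣ_ {n})

open SinkOrClash public using (Refutation)
open SinkOrClash.Refutation public using (size; width)

{-# OPTIONS --safe #-}

-- To find the sink of a face, find the sink u of its lower facet. If u is not
-- a sink of the face, the edge at u leaves the lower facet; remember u and find
-- the sink v of the upper facet. If the edge at v leaves the upper facet, then
-- u and v clash; otherwise v is the sink of the face. At every moment this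
-- search remembers at most one vertex per dimension, together with at most n
-- bits of its outmap. Read backwards as a derivation, its memory states become
-- clauses with O(n²) literals, and unfolding the recursion, not the 2ⁿ steps of
-- the search, gives 2^O(n²) resolution steps.
module Submission where

open import Data.Bool.Base using (Bool; true; false)
import Data.Bool.Properties as Bool
open import Data.Fin.Base using (Fin; zero; suc)
import Data.Fin.Properties as Fin
open import Data.List.Base
  using (List; []; _∷_; _++_; allFin; cartesianProduct; concat; filter; length; map;
         tabulate)
open import Data.List.Membership.Propositional using (_∈_; _∉_; find; lose)
open import Data.List.Membership.Propositional.Properties
  using (∈-++⁺ˡ; ∈-++⁺ʳ; ∈-++⁻; ∈-allFin; ∈-cartesianProduct⁺; ∈-cartesianProductWith⁺;
         ∈-concatMap⁺; ∈-concatMap⁻; ∈-deduplicate⁻; ∈-filter⁺; ∈-filter⁻; ∈-map⁺; ∈-map⁻;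
         ∈-tabulate⁺; ∈-∃++)
open import Data.List.Properties
  using (length-++; length-tabulate; map-tabulate; ++-identityʳ)
open import Data.List.Relation.Binary.BagAndSetEquality using (_∼[_]_; set)
open import Data.List.Relation.Binary.Subset.Propositional using (_⊆_)
open import Data.List.Relation.Binary.Subset.Propositional.Properties
  using (⊆-refl; ⊆-trans; ⊆-reflexive; ⊆[]⇒≡[]; ⊆∷⇒∈∨⊆; xs⊆x∷xs; xs⊆ys++xs; ∷⁺ʳ; ++⁺ʳ;
         ∈-∷⁺ʳ; filter-⊆)
open import Data.List.Relation.Unary.All as All using ([]; _∷_)
open import Data.List.Relation.Unary.Any using (here; there)
open import Data.List.Relation.Unary.Unique.Propositional using (Unique; []; _∷_)
import Data.List.Relation.Unary.Unique.DecPropositional.Properties as DecUnique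
open import Data.Nat using (ℕ; zero; suc; _+_; _*_; _^_; _≤_; _≥_; z≤n; s≤s)
open import Data.Nat.Logarithm
  using (⌈log₂_⌉; ⌊log₂_⌋; ⌈log₂⌉-mono-≤; ⌈log₂2^n⌉≡n; ⌊log₂⌋-mono-≤; ⌊log₂[2^n]⌋≡n)
open import Data.Nat.Properties hiding (_≟_)
open import Data.Nat.Tactic.RingSolver using (solve-∀)
open import Data.Product using (Σ-syntax; ∃-syntax; _×_; _,_; proj₁; proj₂)
open import Data.Sum using (inj₁; inj₂; [_,_]′)
open import Data.Vec.Base as Vec using (Vec; []; _∷_; lookup)
import Data.Vec.Properties as Vec
open import Function.Base using (_∘_; id)
open import Function.Bundles using (mk⇔)
open import Relation.Binary.Definitions using (DecidableEquality)
open import Relation.Binary.PropositionalEquality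
  using (_≡_; _≢_; refl; sym; trans; cong; subst)
open import Relation.Nullary using (yes; no; does; contradiction)
open import Relation.Nullary.Decidable using (¬?; decidable-stable)
open import Defs

-- Derivations of bounded width, up to subsumption.

-- Lets list lengths bound widths: `clauseWidth` measures a deduplicated list, which is `Unique`.
Unique-⊆⇒length≤ : ∀ {A : Set} {xs ys : List A} →
                   Unique xs → xs ⊆ ys → length xs ≤ length ys
Unique-⊆⇒length≤ {xs = []} _ _ = z≤n
Unique-⊆⇒length≤ {xs = x ∷ xs} (x∉xs ∷ xs!) xs⊆ys
  with ys , zs , refl ← ∈-∃++ (xs⊆ys (here refl)) = begin
    suc (length xs)              ≤⟨ s≤s (Unique-⊆⇒length≤ xs! delete-x) ⟩
    suc (length (ys ++ zs))      ≡⟨ cong suc (length-++ ys) ⟩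
    suc (length ys + length zs)  ≡⟨ +-suc (length ys) (length zs) ⟨
    length ys + suc (length zs)  ≡⟨ length-++ ys ⟨
    length (ys ++ x ∷ zs)        ∎
  where
  open ≤-Reasoning
  delete-x : xs ⊆ ys ++ zs
  delete-x y∈xs with ∈-++⁻ ys (xs⊆ys (there y∈xs))
  ... | inj₁ y∈ys         = ∈-++⁺ˡ y∈ys
  ... | inj₂ (here refl)  = contradiction refl (All.lookup x∉xs y∈xs)
  ... | inj₂ (there y∈zs) = ∈-++⁺ʳ ys y∈zs

module BoundedWidth {V : Set} (_≟_ : DecidableEquality V) (F : CNF V) (w : ℕ) where

  open Resolution _≟_

  clauseWidth≤length : ∀ {C D} → C ⊆ D → clauseWidth C ≤ length D
  clauseWidth≤length {C} C⊆D =
    Unique-⊆⇒length≤ (DecUnique.deduplicate-! _≟ˡ_ C) (C⊆D ∘ ∈-deduplicate⁻ _≟ˡ_ C)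

  Bounded : List (Clause V) → Set
  Bounded Γ = Σ[ P ∈ Derivation F Γ ] derivationWidth P ≤ w

  -- Subsumption takes the place of the missing weakening rule.
  infix 4 _⊩_
  _⊩_ : List (Clause V) → Clause V → Set
  Γ ⊩ C = ∃[ E ] E ∈ F ++ Γ × E ⊆ C

  ⊩-weaken : ∀ {Γ C D} → C ⊆ D → Γ ⊩ C → Γ ⊩ D
  ⊩-weaken C⊆D (E , E∈ , E⊆C) = E , E∈ , ⊆-trans E⊆C C⊆D

  ⊩-mono : ∀ {Γ Δ C} → Γ ⊆ Δ → Γ ⊩ C → Δ ⊩ C
  ⊩-mono Γ⊆Δ (E , E∈ , E⊆C) = E , ++⁺ʳ F Γ⊆Δ E∈ , E⊆C

  -- Every step adds one clause, so `t` bounds the number of new steps. Derived clauses are never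
  -- discarded, so later steps can share them and the costs simply add up under `bind`.
  record Extension (t : ℕ) (Q : List (Clause V) → Set) (Γ : List (Clause V)) : Set where
    constructor extension
    field
      {derived} : List (Clause V)
      extends   : Γ ⊆ derived
      length≤   : length derived ≤ t + length Γ
      bounded   : Bounded derived
      result    : Q derived

  bind : ∀ {s t Q R Γ} → Extension s Q Γ →
         (∀ {Δ} → Γ ⊆ Δ → Bounded Δ → Q Δ → Extension t R Δ) →
         Extension (s + t) R Γ
  bind {s} {t} {Γ = Γ} (extension {Δ} Γ⊆Δ Δ≤ b q) next
    with extension {Θ} Δ⊆Θ Θ≤ b′ r ← next Γ⊆Δ b q =
      extension (⊆-trans Γ⊆Δ Δ⊆Θ) (begin
        length Θ            ≤⟨ Θ≤ ⟩
        t + length Δ        ≤⟨ +-monoʳ-≤ t Δ≤ ⟩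
        t + (s + length Γ)  ≡⟨ +-assoc t s _ ⟨
        t + s + length Γ    ≡⟨ cong (_+ length Γ) (+-comm t s) ⟩
        s + t + length Γ    ∎) b′ r
    where open ≤-Reasoning

  -- All occurrences go, since a leftover copy of the pivot could take the resolvent outside the
  -- target clause.
  _-_ : Clause V → Literal V → Clause V
  C - x = filter (λ y → ¬? (y ≟ˡ x)) C

  ∷-minus : ∀ {x C} → x ∈ C → (x ∷ (C - x)) ∼[ set ] C
  ∷-minus {x} {C} x∈C = mk⇔ (∈-∷⁺ʳ x∈C (filter-⊆ _ C)) restore
    where
    restore : C ⊆ x ∷ (C - x)
    restore {y} y∈C with y ≟ˡ x
    ... | yes y≡x = here y≡x
    ... | no  y≢x = there (∈-filter⁺ _ y∈C y≢x)

  minus-⊆ : ∀ {x C D} → D ⊆ x ∷ C → D - x ⊆ C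
  minus-⊆ {x} {C} {D} D⊆x∷C y∈D-x
    with y∈D , y≢x ← ∈-filter⁻ (λ y → ¬? (y ≟ˡ x)) {xs = D} y∈D-x
    with D⊆x∷C y∈D
  ... | here y≡x  = contradiction y≡x y≢x
  ... | there y∈C = y∈C

  -- The premises are known only up to subsumption. If a subsuming clause lacks the pivot, it
  -- already subsumes `C` and no step is made; hence the cost is at most 1 rather than exactly 1.
  resolveOn : ∀ {Γ} x C → suc (length C) ≤ w → Bounded Γ →
              Γ ⊩ x ∷ C → Γ ⊩ negate x ∷ C → Extension 1 (_⊩ C) Γ
  resolveOn {Γ} x C C<w b (D , D∈ , D⊆) (E , E∈ , E⊆)
    with ⊆∷⇒∈∨⊆ D⊆ | ⊆∷⇒∈∨⊆ E⊆
  ... | inj₂ D⊆C | _        = extension ⊆-refl (n≤1+n _) b (D , D∈ , D⊆C)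
  ... | inj₁ _   | inj₂ E⊆C = extension ⊆-refl (n≤1+n _) b (E , E∈ , E⊆C)
  ... | inj₁ x∈D | inj₁ ¬x∈E =
    extension (xs⊆x∷xs Γ R) ≤-refl
      ( resolve D′ E′ x (proj₁ b) (lose D∈ (∷-minus x∈D)) (lose E∈ (∷-minus ¬x∈E))
          (mk⇔ id id)
      , ⊔-lub (⊔-lub (⊔-lub (≤-trans (clauseWidth≤length (∷⁺ʳ x D′⊆C)) C<w)
                            (≤-trans (clauseWidth≤length (∷⁺ʳ (negate x) E′⊆C)) C<w))
                     (≤-trans (clauseWidth≤length R⊆C) (≤-trans (n≤1+n _) C<w)))
              (proj₂ b))
      (R , ∈-++⁺ʳ F (here refl) , R⊆C)
    where
    D′ = D - x
    E′ = E - negate x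
    R = D′ ++ E′
    D′⊆C : D′ ⊆ C
    D′⊆C = minus-⊆ D⊆
    E′⊆C : E′ ⊆ C
    E′⊆C = minus-⊆ E⊆
    R⊆C : R ⊆ C
    R⊆C = [ D′⊆C , E′⊆C ]′ ∘ ∈-++⁻ D′

  -- The vertices are treated one after another, so `step` has to start from any extension of `Γ`:
  -- the clauses for earlier vertices have been added by then.
  forEach : ∀ k {t Γ} (G : Vec Bool k → Clause V) → Bounded Γ →
            (∀ {Δ} u → Γ ⊆ Δ → Bounded Δ → Extension t (_⊩ G u) Δ) →
            Extension (2 ^ k * t) (λ Δ → ∀ u → Δ ⊩ G u) Γ
  forEach zero {t} {Γ} G b step
    with extension Γ⊆Δ Δ≤ b′ r ← step [] ⊆-refl b =
    extension Γ⊆Δ (≤-trans Δ≤ (≤-reflexive (cong (_+ length Γ) (sym (*-identityˡ t))))) b′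
      λ { [] → r }
  forEach (suc k) {t} {Γ} G b step =
    subst (λ s → Extension s (λ Δ → ∀ u → Δ ⊩ G u) Γ) (double (2 ^ k) t)
    (bind (forEach k (G ∘ (false ∷_)) b (λ u → step (false ∷ u))) λ Γ⊆Δ b₁ r₁ →
     bind (forEach k (G ∘ (true ∷_)) b₁
             (λ u Δ⊆Θ → step (true ∷ u) (⊆-trans Γ⊆Δ Δ⊆Θ))) λ Δ⊆Θ b₂ r₂ →
     extension {0} ⊆-refl ≤-refl b₂ λ
       { (false ∷ u) → ⊩-mono Δ⊆Θ (r₁ u)
       ; (true  ∷ u) → r₂ u })
    where
    double : ∀ m t → m * t + (m * t + 0) ≡ (2 * m) * t
    double = solve-∀

  derivationSize≡length : ∀ {Γ} (P : Derivation F Γ) → derivationSize P ≡ length Γ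
  derivationSize≡length start                   = refl
  derivationSize≡length (resolve _ _ _ P _ _ _) = cong suc (derivationSize≡length P)

  -- A `Refutation` has to end with the empty clause; steps made after its most recent occurrence
  -- are cut off.
  refute : ∀ {Γ} → [] ∈ Γ → Bounded Γ →
           Σ[ P ∈ Resolution.Refutation _≟_ F ]
             Resolution.Refutation.size P ≤ length Γ × Resolution.Refutation.width P ≤ w
  refute (here refl) (P , P≤w) =
    record { derivation = P } , ≤-reflexive (derivationSize≡length P) , P≤w
  refute (there []∈Γ) (resolve C D x P _ _ _ , P≤w)
    with Q , Q≤ , Q≤w ← refute []∈Γ (P , m⊔n≤o⇒n≤o _ _ P≤w) =
    Q , ≤-trans Q≤ (n≤1+n _) , Q≤w

-- The clauses of the formula.

∈-boolVecs : ∀ {n} (u : Vec Bool n) → u ∈ boolVecs n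
∈-boolVecs [] = here refl
∈-boolVecs (false ∷ u) =
  ∈-cartesianProductWith⁺ _∷_ {xs = false ∷ true ∷ []} (here refl) (∈-boolVecs u)
∈-boolVecs (true  ∷ u) =
  ∈-cartesianProductWith⁺ _∷_ {xs = false ∷ true ∷ []} (there (here refl)) (∈-boolVecs u)

notSink∈ : ∀ {n} (u : Vertex n) → notSink u ∈ sinkOrClash n
notSink∈ u = ∈-++⁺ˡ (∈-map⁺ notSink (∈-boolVecs u))

notClash∈ : ∀ {n} {u v : Vertex n} → u ≢ v → ∀ o → notClash u v o ∈ sinkOrClash n
notClash∈ {n} {u} {v} u≢v o =
  ∈-++⁺ʳ (map notSink (boolVecs n))
    (∈-concatMap⁺ _ (lose (∈-filter⁺ _ (∈-cartesianProduct⁺ (∈-boolVecs u) (∈-boolVecs v)) u≢v)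
                          (∈-map⁺ (notClash u v) (∈-boolVecs o))))

-- This is `notClash` with `differing u v` generalized to an arbitrary list, which makes induction
-- on the list possible.
clashLiterals : ∀ {n} (u v : Vertex n) (is : List (Fin n)) → Vec Bool (length is) →
                Clause (Var n)
clashLiterals u v is o = concat (Vec.toList (Vec.zipWith
  (λ i b → ((u , i) ≠ˡ b) ∷ ((v , i) ≠ˡ b) ∷ []) (Vec.fromList is) o))

clashLiterals-⊆ : ∀ {n} {u v : Vertex n} (g : Fin n → Bool) {C} is →
                  (∀ {i} → i ∈ is → (u , i) ≠ˡ g i ∈ C × (v , i) ≠ˡ g i ∈ C) →
                  clashLiterals u v is (Vec.map g (Vec.fromList is)) ⊆ C
clashLiterals-⊆ g (i ∷ is) lits (here refl)         = proj₁ (lits (here refl))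
clashLiterals-⊆ g (i ∷ is) lits (there (here refl)) = proj₂ (lits (here refl))
clashLiterals-⊆ g (i ∷ is) lits (there (there ℓ∈))  = clashLiterals-⊆ g is (lits ∘ there) ℓ∈

clashLiterals≡[] : ∀ {n} {u v : Vertex n} is o → [] ≡ clashLiterals u v is o → is ≡ []
clashLiterals≡[] []       []      _ = refl
clashLiterals≡[] (i ∷ is) (b ∷ o) ()

differing≡[]⇒≡ : ∀ {n} (u v : Vertex n) → differing u v ≡ [] → u ≡ v
differing≡[]⇒≡ u v d≡[] = trans (sym (Vec.tabulate∘lookup u))
  (trans (Vec.tabulate-cong agree) (Vec.tabulate∘lookup v))
  where
  agree : ∀ i → lookup u i ≡ lookup v i
  agree i = decidable-stable (lookup u i Bool.≟ lookup v i) λ uᵢ≢vᵢ →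
    contradiction (subst (i ∈_) d≡[] (∈-filter⁺ _ (∈-allFin i) uᵢ≢vᵢ)) λ ()

-- Needed because `⊩` also accepts clauses of the formula, whereas a `Refutation` must derive the
-- empty clause by a step. For n = 0 the sink clause of the only vertex is empty.
[]∉sinkOrClash : ∀ {n} → n ≥ 1 → [] ∉ sinkOrClash n
[]∉sinkOrClash {suc n} _ []∈ with ∈-++⁻ (map notSink (boolVecs (suc n))) []∈
... | inj₁ []∈sinks with _ , _ , () ← ∈-map⁻ notSink []∈sinks
... | inj₂ []∈clashes
  with (u , v) , uv∈ , []∈uv ← find (∈-concatMap⁻ _ {xs = distinctPairs (suc n)} []∈clashes)
  with o , _ , eq ← ∈-map⁻ (notClash u v) []∈uv =
  proj₂ (∈-filter⁻ (λ (u , v) → ¬? (u ≟ᵛ v))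
           {xs = cartesianProduct (boolVecs (suc n)) (boolVecs (suc n))} uv∈)
    (differing≡[]⇒≡ u v (clashLiterals≡[] {u = u} {v = v} (differing u v) o eq))

-- Faces of the cube.

-- `vertex` embeds the k-cube and `coord` lists the free directions. The fixed bits enter only
-- through `differ-coord`: vertices of a face differ only in free directions, so clashes inside a
-- face depend on those directions alone.
record Face (k n : ℕ) : Set where
  field
    vertex : Vec Bool k → Vertex n
    coord  : Fin k → Fin n
    lookup-coord : ∀ u i → lookup (vertex u) (coord i) ≡ lookup u i
    differ-coord : ∀ {u v j} → lookup (vertex u) j ≢ lookup (vertex v) j → ∃[ i ] coord i ≡ j

open Face

wholeCube : ∀ n → Face n n
wholeCube n = record
  { vertex = id ; coord = id ; lookup-coord = λ _ _ → refl ; differ-coord = λ _ → _ , refl }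

facet : ∀ {k n} → Bool → Face (suc k) n → Face k n
facet b φ = record
  { vertex       = vertex φ ∘ (b ∷_)
  ; coord        = coord φ ∘ suc
  ; lookup-coord = λ u i → lookup-coord φ (b ∷ u) (suc i)
  ; differ-coord = λ {u} {v} p≢q → shift u v p≢q (differ-coord φ p≢q)
  }
  where
  shift : ∀ u v {j} → lookup (vertex φ (b ∷ u)) j ≢ lookup (vertex φ (b ∷ v)) j →
          ∃[ i ] coord φ i ≡ j → ∃[ i ] coord φ (suc i) ≡ j
  -- Both vertices carry the bit `b` in the direction that the facet fixes, so they cannot differ
  -- there.
  shift u v p≢q (zero , refl) = contradiction
    (trans (lookup-coord φ (b ∷ u) zero) (sym (lookup-coord φ (b ∷ v) zero))) p≢q
  shift u v p≢q (suc i , eq)  = i , eq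

notSinkOf : ∀ {k n} → Face k n → Vec Bool k → Clause (Var n)
notSinkOf φ u = tabulate λ i → pos (vertex φ u , coord φ i)

-- Deriving the empty clause by recursion on faces.

-- The recurrence mirrors `eliminateSink`: for each of the 2^k vertices u of the lower facet, one
-- resolution per vertex v of the upper facet, a recursive call on the upper facet and one more
-- resolution; then a single call on the lower facet.
steps : ℕ → ℕ
steps zero    = 0
steps (suc k) = 2 ^ k * (2 ^ k * 1 + (steps k + 1)) + steps k

-- The increment from k to k + 1 is 2(k + 1), which is what the premises over `upper v ++ exit u`
-- add to the side clause `A`: k + 1 literals for each of the two facet sinks.
budget : ℕ → ℕ
budget k = k * k + k

module Sweep (n : ℕ) where

  open BoundedWidth (_≟ˣ_ {n}) (sinkOrClash n) (budget n)

  -- If both vertices are sinks of their facets and both edges between the facets are outgoing, the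
  -- two outmaps agree on every free direction of `φ`, hence wherever the vertices differ. The
  -- clause is thus subsumed by a single clash clause.
  facetSinksClash : ∀ {k Γ A} (φ : Face (suc k) n) u v →
    Γ ⊩ neg (vertex φ (true ∷ v) , coord φ zero) ∷ (notSinkOf (facet true φ) v ++
        (neg (vertex φ (false ∷ u) , coord φ zero) ∷ notSinkOf (facet false φ) u ++ A))
  facetSinksClash {A = A} φ u v =
    _ , ∈-++⁺ˡ (notClash∈ p≢q (Vec.map out (Vec.fromList (differing p q)))) ,
      (clashLiterals-⊆ {u = p} {v = q} out (differing p q) λ i∈ →
        literals (differ-coord φ
          (proj₂ (∈-filter⁻ (λ i → ¬? (lookup p i Bool.≟ lookup q i)) {xs = allFin n} i∈))))
    where
    p = vertex φ (false ∷ u)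
    q = vertex φ (true ∷ v)

    p≢q : p ≢ q
    p≢q p≡q with () ← trans (sym (lookup-coord φ (false ∷ u) zero))
                        (trans (cong (λ r → lookup r (coord φ zero)) p≡q)
                               (lookup-coord φ (true ∷ v) zero))

    out : Fin n → Bool
    -- The common outmap value: outgoing in the direction that separates the facets, incoming in the
    -- other free directions.
    out j = does (j Fin.≟ coord φ zero)

    lower = notSinkOf (facet false φ) u
    upper = notSinkOf (facet true φ) v
    C = neg (q , coord φ zero) ∷ (upper ++ (neg (p , coord φ zero) ∷ lower ++ A))

    literals : ∀ {j} → ∃[ i ] coord φ i ≡ j → (p , j) ≠ˡ out j ∈ C × (q , j) ≠ˡ out j ∈ C
    literals {j} (i , eq) with j Fin.≟ coord φ zero
    ... | yes refl = there (∈-++⁺ʳ upper (here refl)) , here refl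
    literals (zero  , refl) | no j≢0 = contradiction refl j≢0
    literals (suc i , refl) | no j≢0 =
        there (∈-++⁺ʳ upper (there (∈-++⁺ˡ (∈-tabulate⁺ {f = λ i → pos (p , coord φ (suc i))} i))))
      , there (∈-++⁺ˡ (∈-tabulate⁺ {f = λ i → pos (q , coord φ (suc i))} i))

  -- `A` is the negated memory. The call on the upper facet is made once per u, with u added to the
  -- memory as `exit u`; the call on the lower facet starts from `A` again, so the memory grows only
  -- along nested calls.
  eliminateSink : ∀ k (φ : Face k n) A {Γ} → length A + budget k ≤ budget n → Bounded Γ →
                  (∀ u → Γ ⊩ notSinkOf φ u ++ A) → Extension (steps k) (_⊩ A) Γ
  -- A single vertex has no free directions, so its sink clause is empty.
  eliminateSink zero    φ A A≤ b noSink = extension ⊆-refl ≤-refl b (noSink [])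
  eliminateSink (suc k) φ A {Γ} A≤ b noSink =
    bind (forEach k (λ u → lower u ++ A) b λ u Γ⊆Δ b₁ →
      bind (forEach k (λ v → upper v ++ exit u) b₁ λ v Δ⊆Θ b₂ →
              -- Case distinction on the edge at v: if incoming, v would be a sink of `φ`; if
              -- outgoing, it would clash with u.
              resolveOn (pos (q v)) (upper v ++ exit u) (upper-exit≤ u v) b₂
                (⊩-weaken (∷⁺ʳ _ (++⁺ʳ (upper v) (xs⊆ys++xs A (neg (p u) ∷ lower u))))
                  (⊩-mono (⊆-trans Γ⊆Δ Δ⊆Θ) (noSink (true ∷ v))))
                (facetSinksClash φ u v))
      λ Δ⊆Θ b₂ noUpperSink →
      bind (eliminateSink k (facet true φ) (exit u) (exit≤ u) b₂ noUpperSink)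
      λ Θ⊆Λ b₃ ⊩exit →
      -- `notSinkOf φ (false ∷ u)` unfolds to `pos (p u) ∷ lower u`, while `exit u` starts with
      -- `neg (p u)`; the resolvent excludes u as a sink of the lower facet.
      resolveOn (pos (p u)) (lower u ++ A) (lower≤ u) b₃
        (⊩-mono (⊆-trans Γ⊆Δ (⊆-trans Δ⊆Θ Θ⊆Λ)) (noSink (false ∷ u))) ⊩exit)
    λ _ b₁ → eliminateSink k (facet false φ) A
               (≤-trans (+-monoʳ-≤ (length A) budget≤budget-suc) A≤) b₁
    where
    lower upper exit : Vec Bool k → Clause (Var n)
    p q : Vec Bool k → Var n
    p u = vertex φ (false ∷ u) , coord φ zero
    q v = vertex φ (true ∷ v) , coord φ zero
    lower = notSinkOf (facet false φ)
    upper = notSinkOf (facet true φ)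
    exit u = neg (p u) ∷ lower u ++ A

    budget≤budget-suc : budget k ≤ budget (suc k)
    budget≤budget-suc = +-mono-≤ (*-mono-≤ (n≤1+n k) (n≤1+n k)) (n≤1+n k)

    length-notSinkOf : ∀ (ψ : Face k n) u B →
                       length (notSinkOf ψ u ++ B) ≡ k + length B
    length-notSinkOf ψ u B =
      trans (length-++ (notSinkOf ψ u)) (cong (_+ length B) (length-tabulate _))

    open ≤-Reasoning

    exit≤ : ∀ u → length (exit u) + budget k ≤ budget n
    exit≤ u = begin
      suc (length (lower u ++ A)) + budget k   ≡⟨ cong (λ l → suc l + budget k)
                                                       (length-notSinkOf (facet false φ) u A) ⟩
      suc (k + length A) + budget k            ≤⟨ m≤m+n _ (k + 1) ⟩
      suc (k + length A) + budget k + (k + 1)  ≡⟨ lemma k (length A) ⟩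
      length A + budget (suc k)                ≤⟨ A≤ ⟩
      budget n                                 ∎
      where
      lemma : ∀ k a → (1 + (k + a)) + (k * k + k) + (k + 1) ≡
                      a + ((1 + k) * (1 + k) + (1 + k))
      lemma = solve-∀

    upper-exit≤ : ∀ u v → suc (length (upper v ++ exit u)) ≤ budget n
    upper-exit≤ u v = begin
      suc (length (upper v ++ exit u))         ≡⟨ cong suc (length-notSinkOf (facet true φ) v (exit u)) ⟩
      suc (k + length (exit u))                ≡⟨ cong (λ l → suc (k + suc l))
                                                       (length-notSinkOf (facet false φ) u A) ⟩
      suc (k + suc (k + length A))             ≤⟨ m≤m+n _ (budget k) ⟩
      suc (k + suc (k + length A)) + budget k  ≡⟨ lemma k (length A) ⟩
      length A + budget (suc k)                ≤⟨ A≤ ⟩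
      budget n                                 ∎
      where
      lemma : ∀ k a → (1 + (k + (1 + (k + a)))) + (k * k + k) ≡
                      a + ((1 + k) * (1 + k) + (1 + k))
      lemma = solve-∀

    lower≤ : ∀ u → suc (length (lower u ++ A)) ≤ budget n
    lower≤ u = ≤-trans (m≤m+n _ (budget k)) (exit≤ u)

  refutation : n ≥ 1 → Σ[ P ∈ Refutation (sinkOrClash n) ] size P ≤ steps n × width P ≤ budget n
  refutation n≥1
    with extension {Γ} _ Γ≤ b (C , C∈ , C⊆[]) ←
      eliminateSink n (wholeCube n) [] ≤-refl (Resolution.start , z≤n)
        (λ u → _ , ∈-++⁺ˡ (notSink∈ u) , ⊆-reflexive
          (trans (map-tabulate id _) (sym (++-identityʳ _))))
    with refl ← ⊆[]⇒≡[] C⊆[]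
    with ∈-++⁻ (sinkOrClash n) C∈
  ... | inj₁ []∈F = contradiction []∈F ([]∉sinkOrClash n≥1)
  ... | inj₂ []∈Γ with P , P≤Γ , P≤w ← refute []∈Γ b =
    P , ≤-trans P≤Γ (≤-trans Γ≤ (≤-reflexive (+-identityʳ (steps n)))) , P≤w

-- The polylogarithmic bound.

-- The strict bound makes the induction go through: the recurrence closes up in `suc (steps k)`,
-- which absorbs its additive ones.
steps<2^budget : ∀ k → suc (steps k) ≤ 2 ^ budget k
steps<2^budget zero    = ≤-refl
steps<2^budget (suc k) = begin
  suc (2 ^ k * (2 ^ k * 1 + (s + 1)) + s)  ≡⟨ regroup (2 ^ k) s ⟩
  2 ^ k * (2 ^ k + suc s) + suc s          ≤⟨ +-mono-≤ (*-monoʳ-≤ (2 ^ k) (+-mono-≤ 2^k≤b ih)) ih ⟩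
  -- The lone `b` is overestimated so that the sum becomes `b` times a power of two.
  2 ^ k * (b + b) + b                      ≤⟨ +-monoʳ-≤ _ (m≤n*m b (2 * 2 ^ k)) ⟩
  2 ^ k * (b + b) + 2 * 2 ^ k * b          ≡⟨ collect (2 ^ k) b ⟩
  b * (4 * 2 ^ k)                          ≡⟨ cong (b *_) (^-distribˡ-+-* 2 2 k) ⟨
  b * 2 ^ (2 + k)                          ≡⟨ ^-distribˡ-+-* 2 (budget k) (2 + k) ⟨
  2 ^ (budget k + (2 + k))                 ≤⟨ ^-monoʳ-≤ 2 (m≤m+n (budget k + (2 + k)) k) ⟩
  2 ^ (budget k + (2 + k) + k)             ≡⟨ cong (2 ^_) (budget-suc k) ⟩
  2 ^ budget (suc k)                       ∎
  where
  open ≤-Reasoning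
  s = steps k
  b = 2 ^ budget k
  ih = steps<2^budget k
  2^k≤b : 2 ^ k ≤ b
  2^k≤b = ^-monoʳ-≤ 2 (m≤n+m k (k * k))
  instance
    _ = m*n≢0 2 (2 ^ k) {{_}} {{m^n≢0 2 k}}
  regroup : ∀ m s → 1 + (m * (m * 1 + (s + 1)) + s) ≡ m * (m + (1 + s)) + (1 + s)
  regroup = solve-∀
  collect : ∀ m b → m * (b + b) + 2 * m * b ≡ b * (4 * m)
  collect = solve-∀
  budget-suc : ∀ k → k * k + k + (2 + k) + k ≡ (1 + k) * (1 + k) + (1 + k)
  budget-suc = solve-∀

n≤⌊log₂[n*2^n]⌋ : ∀ n → n ≥ 1 → n ≤ ⌊log₂ (n * 2 ^ n) ⌋
n≤⌊log₂[n*2^n]⌋ n@(suc _) _ = begin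
  n                    ≡⟨ ⌊log₂[2^n]⌋≡n n ⟨
  ⌊log₂ (2 ^ n) ⌋      ≤⟨ ⌊log₂⌋-mono-≤ (m≤n*m (2 ^ n) n) ⟩
  ⌊log₂ (n * 2 ^ n) ⌋  ∎
  where open ≤-Reasoning

corollary38 : Σ[ P ∈ (∀ n → n ≥ 1 → Refutation (sinkOrClash n)) ]
    Σ[ p ∈ Polynomial ]
    (∀ n (n≥1 : n ≥ 1) →
    let N = n * 2 ^ n in
    ⌈log₂ size (P n n≥1) ⌉ + width (P n n≥1) ≤ ⟦ p ⟧ ⌊log₂ N ⌋)
corollary38 =
    (λ n n≥1 → proj₁ (refutation n n≥1))
  -- The polynomial 2L + 2L² is twice the budget at L: once for the logarithm of the size, once for
  -- the width.
  , 0 ∷ 2 ∷ 2 ∷ []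
  , λ n n≥1 →
      let P , P≤steps , P≤budget = refutation n n≥1
          L = ⌊log₂ (n * 2 ^ n) ⌋
          n≤L = n≤⌊log₂[n*2^n]⌋ n n≥1
          size≤ = ≤-trans P≤steps (≤-trans (n≤1+n _) (steps<2^budget n))
      in begin
        ⌈log₂ size P ⌉ + width P           ≤⟨ +-mono-≤ (⌈log₂⌉-mono-≤ size≤) P≤budget ⟩
        ⌈log₂ (2 ^ budget n) ⌉ + budget n  ≡⟨ cong (_+ budget n) (⌈log₂2^n⌉≡n (budget n)) ⟩
        budget n + budget n                ≤⟨ +-mono-≤ (budget-mono n≤L) (budget-mono n≤L) ⟩
        budget L + budget L                ≡⟨ horner L ⟩
        ⟦ 0 ∷ 2 ∷ 2 ∷ [] ⟧ L               ∎
  where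
  open ≤-Reasoning
  open Sweep using (refutation)
  budget-mono : ∀ {m n} → m ≤ n → budget m ≤ budget n
  budget-mono m≤n = +-mono-≤ (*-mono-≤ m≤n m≤n) m≤n
  horner : ∀ l → (l * l + l) + (l * l + l) ≡ 0 + l * (2 + l * (2 + l * 0))
  horner = solve-∀
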